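{- Let $a,b\in\mathbb Z$. Every generic solution of the hypergeometric equation $$(\Delta-[-a])(\Delta-[-b])u=d\Delta u$$ is strongly singular. Explicitly: let $(c_i)_{i\ge 0}$ be a sequence in $\overline{K}_c$ satisfying $$\left(c_{i+2}^{1/q}-c_{i+2}\right)+c_{i+1}^{1/q}[i+1]^{1/q}-c_{i+1}\big([i]+[i+1]-[-a]-[-b]\big)-c_i\big([i]-[-a]\big)\big([i]-[-b]\big)=0,\quad i=0,1,2,\ldots$$ (equivalently, such that $u(t)=\sum_{i\ge 0}c_if_i(t)$, $t\in\mathbf F_q[x]$, is a solution of the equation on $\mathbf F_q[x]$), and suppose that the solution is generic, i.e. there is an $N$ such that for all $n\ge N$ the coefficient $c_n$ is chosen as a solution $z$ with $|z|=1$ of the corresponding equation $z^{1/q}-z=v$. Then the series $\sum_{i\ge 0}c_if_i(t)$ does not converge at any point $t\in O\setminus\mathbf F_q[x]$.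
   Context: Let $q$ be a power of a prime $p$, and let $K=\mathbf F_q((x))$ with absolute value $|t|=q^{ -N}$ for $t=\sum_{j\ge N}\xi_jx^j$, $\xi_N\ne 0$, and $|0|=0$. Let $O=\{t\in K:|t|\le 1\}=\mathbf F_q[[x]]$, and let $\overline{K}_c$ be the completion of an algebraic closure of $K$ with the uniquely extended absolute value. For $j\in\mathbb Z$ put $[j]=x^{q^j}-x\in\overline{K}_c$ (for negative $j$, $x^{q^j}$ is the unique $q^{|j|}$-th root of $x$). Carlitz polynomials: $f_i=D_i^{ -1}e_i$, with $D_0=1$, $D_i=[i][i-1]^q\cdots[1]^{q^{i-1}}$, $e_0(t)=t$, $e_i(t)=\prod_{\omega\in\mathbf F_q[x],\,\deg\omega<i}(t-\omega)$ for $i\ge 1$ (including $\omega=0$). For $t\in\mathbf F_q[x]$ only finitely many terms of $\sum c_if_i(t)$ are non-zero. Operators: $(\Delta u)(t)=u(xt)-xu(t)$ and $d=\sqrt[q]{\ }\circ\Delta$; they are well defined on $\mathbf F_q$-linear functions on $\mathbf F_q[x]$. Given $c_i,c_{i+1}$, the recursion determines $c_{i+2}$ as a solution $z=c_{i+2}$ of an equation $z^{1/q}-z=v$, where $v$ depends on $c_i,c_{i+1}$; the initial coefficients $c_0,c_1\in\overline{K}_c$ are arbitrary. A solution is called generic if, starting from a certain step of finding the coefficients $c_n$, one always takes a solution $z$ with $|z|=1$. A formal series $\sum c_if_i(t)$ is called strongly singular if it converges at no point $t\in O\setminus\mathbf F_q[x]$. -}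

module Defs where

open import Level using (Level; _⊔_) renaming (suc to lsuc)
open import Algebra.Core using (Op₁)
open import Algebra.Bundles using (CommutativeRing; RawRing)
open import Algebra.Morphism.Structures using (module RingMorphisms)
import Algebra.Definitions.RawSemiring as RawSemiringOps
import Algebra.Properties.Ring as RingProperties
import Algebra.Properties.Group as GroupProperties
import Algebra.Properties.Semiring.Mult as SemiringMult
import Algebra.Properties.CommutativeMonoid.Sum as MonoidSum
import Algebra.Properties.CommutativeSemiring.Exp as Exp
import Algebra.Properties.CommutativeSemiring.Binomial as Binomial
open import Data.Nat.Base as ℕ using (ℕ; zero; suc; _∸_; z≤n; s≤s)
import Data.Nat.Properties as ℕₚ
open import Data.Nat.Combinatorics using (_C_; nC1≡n; nCn≡1; k>n⇒nCk≡0; nCk+nC[k+1]≡[n+1]C[k+1])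
open import Data.Nat.Divisibility using (_∣_; divides; m∣m*n; >⇒∤)
open import Data.Nat.Primality using (Prime; euclidsLemma; ¬prime[0])
open import Data.Integer.Base as ℤ using (ℤ; +_; -[1+_])
import Data.Integer.Properties as ℤₚ
open import Data.Rational.Base as ℚ using (ℚ; _/_; 0ℚ; 1ℚ; *≤*; mkℚ)
import Data.Rational.Properties as ℚₚ
open import Data.Rational.Unnormalised.Base as ℚᵘ using (mkℚᵘ)
import Data.Rational.Unnormalised.Properties as ℚᵘₚ
open import Data.Fin.Base as Fin using (Fin; toℕ; fromℕ; inject₁)
import Data.Fin.Properties as Finₚ
open import Data.Fin.Permutation using (Permutation; permutation)
open import Data.List.Base as List using (List; []; _∷_; applyUpTo; cartesianProductWith)
open import Data.Product.Base using (∃; ∃₂; _×_; _,_; proj₁; proj₂)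
open import Data.Sum.Base using (inj₁; inj₂)
open import Data.Empty using (⊥-elim)
open import Function.Base using (_∘_)
open import Function.Bundles using (Inverse)
open import Relation.Binary.PropositionalEquality.Core as ≡ using (_≡_)
import Relation.Binary.PropositionalEquality.Properties as ≡
import Relation.Binary.Reasoning.Setoid as SetoidReasoning
open import Relation.Nullary using (¬_; Dec; yes; no)
open import Relation.Nullary.Decidable using (map′)

record Field (c ℓ : Level) : Set (lsuc (c ⊔ ℓ)) where
  infix 9 _⁻¹
  field
    commutativeRing : CommutativeRing c ℓ
  open CommutativeRing commutativeRing public hiding (zero)
  field
    1≉0          : 1# ≉ 0#
    -- The value of 0# ⁻¹ is left unspecified.
    _⁻¹          : Op₁ Carrier
    *-inverseʳ   : ∀ {x} → x ≉ 0# → x * x ⁻¹ ≈ 1#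

  open RawSemiringOps (RawRing.rawSemiring rawRing) public using (sum; _^_)

record FiniteField (c ℓ : Level) (q : ℕ) : Set (lsuc (c ⊔ ℓ)) where
  field
    𝔽 : Field c ℓ
  open Field 𝔽 public
  field
    enumeration : Inverse setoid (≡.setoid (Fin q))

  elements : List Carrier
  elements = List.map (Inverse.from enumeration) (List.allFin q)

module _ {c ℓ : Level} (F : Field c ℓ) where
  open Field F

  PowerSeries : Set c
  PowerSeries = ℕ → Carrier

  IsPolynomial : PowerSeries → Set ℓ
  IsPolynomial t = ∃ λ N → ∀ n → N ℕ.≤ n → t n ≈ 0#

  infix 5 x^-_·_
  record LaurentSeries : Set c where
    constructor x^-_·_
    field
      pole  : ℕ
      coeff : PowerSeries

  multiplyByX^ : ℕ → PowerSeries → PowerSeries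
  multiplyByX^ zero    t n       = t n
  multiplyByX^ (suc m) t zero    = 0#
  multiplyByX^ (suc m) t (suc n) = multiplyByX^ m t n

  constant : Carrier → PowerSeries
  constant a zero    = a
  constant a (suc _) = 0#

  laurentSeries : RawRing c ℓ
  laurentSeries = record
    { Carrier = LaurentSeries
    ; _≈_     = λ { (x^- m · s) (x^- n · t) → ∀ k → multiplyByX^ n s k ≈ multiplyByX^ m t k }
    ; _+_     = λ { (x^- m · s) (x^- n · t) →
                    x^- (m ℕ.+ n) · (λ k → multiplyByX^ n s k + multiplyByX^ m t k) }
    ; _*_     = λ { (x^- m · s) (x^- n · t) →
                    x^- (m ℕ.+ n) · (λ k → sum {suc k} (λ i → s (toℕ i) * t (k ∸ toℕ i))) }
    ; -_      = λ { (x^- m · s) → x^- m · (λ k → - s k) }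
    ; 0#      = x^- 0 · constant 0#
    ; 1#      = x^- 0 · constant 1#
    }

  -- The order of x^- m · s is k - m, where k is the least index with s k ≉ 0#.
  HasOrder : LaurentSeries → ℤ → Set ℓ
  HasOrder (x^- m · s) N =
    ∃ λ k → N ≡ + k ℤ.- + m × (s k ≉ 0#) × (∀ j → j ℕ.< k → s j ≈ 0#)

-- The values 0 and q^{-r} with r rational. These are all the absolute values
-- occurring on an algebraic closure of 𝔽q((x)) (an element of degree n over
-- 𝔽q((x)) has a value in q^{(1/n)ℤ}) and on its completion.
data Value : Set where
  0ᵛ   : Value
  q^-_ : ℚ → Value

infixl 7 _·_
_·_ : Value → Value → Value
0ᵛ     · _      = 0ᵛ
q^- _  · 0ᵛ     = 0ᵛ
q^- r  · q^- s  = q^- (r ℚ.+ s)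

infix 4 _≼_
data _≼_ : Value → Value → Set where
  0≼    : ∀ {v} → 0ᵛ ≼ v
  q^-≼  : ∀ {r s} → s ℚ.≤ r → q^- r ≼ q^- s

record AbsoluteValue {c ℓ : Level} (L : Field c ℓ) : Set (c ⊔ ℓ) where
  open Field L
  field
    ‖_‖         : Carrier → Value
    ‖‖-cong     : ∀ {x y} → x ≈ y → ‖ x ‖ ≡ ‖ y ‖
    ‖0‖         : ‖ 0# ‖ ≡ 0ᵛ
    ‖‖≡0⇒≈0     : ∀ {x} → ‖ x ‖ ≡ 0ᵛ → x ≈ 0#
    ‖‖-*        : ∀ x y → ‖ x * y ‖ ≡ ‖ x ‖ · ‖ y ‖
    ultrametric : ∀ {x y v} → ‖ x ‖ ≼ v → ‖ y ‖ ≼ v → ‖ x + y ‖ ≼ v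

  IsCauchy : (ℕ → Carrier) → Set
  IsCauchy s = ∀ r → ∃ λ N → ∀ m n → N ℕ.≤ m → N ℕ.≤ n → ‖ s m - s n ‖ ≼ q^- r

  _⟶_ : (ℕ → Carrier) → Carrier → Set
  s ⟶ z = ∀ r → ∃ λ N → ∀ n → N ℕ.≤ n → ‖ s n - z ‖ ≼ q^- r

  Converges : (ℕ → Carrier) → Set c
  Converges s = ∃ (s ⟶_)

module _ {c ℓ : Level} (L : Field c ℓ) where
  open Field L

  -- z ^ n + a (n-1) z ^ (n-1) + ⋯ + a 0
  monic : {n : ℕ} → (Fin n → Carrier) → Carrier → Carrier
  monic {n} a z = z ^ n + sum (λ i → a i * z ^ toℕ i)

record AlgebraicClosure {c ℓ : Level} (K : RawRing c ℓ) : Set (lsuc (c ⊔ ℓ)) where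
  field
    closure : Field c ℓ
  open Field closure public
  open RingMorphisms K rawRing using (IsRingMonomorphism)
  field
    embed               : RawRing.Carrier K → Carrier
    embed-mono          : IsRingMonomorphism embed
    algebraic           : ∀ z → ∃₂ λ n (a : Fin n → RawRing.Carrier K) →
                          monic closure (embed ∘ a) z ≈ 0#
    algebraicallyClosed : ∀ n (a : Fin (suc n) → Carrier) → ∃ λ z → monic closure a z ≈ 0#

record Completion {c ℓ : Level} (L : Field c ℓ) (abs : AbsoluteValue L) : Set (lsuc (c ⊔ ℓ)) where
  private
    module L = Field L
    module ∣L∣ = AbsoluteValue abs
  field
    completion    : Field c ℓ
    absoluteValue : AbsoluteValue completion
  open Field completion public
  open AbsoluteValue absoluteValue public
  open RingMorphisms L.rawRing rawRing using (IsRingHomomorphism)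
  field
    embed          : L.Carrier → Carrier
    embed-homo     : IsRingHomomorphism embed
    embed-isometry : ∀ x → ‖ embed x ‖ ≡ ∣L∣.‖ x ‖
    dense          : ∀ z r → ∃ λ x → ‖ embed x - z ‖ ≼ q^- r
    complete       : ∀ s → IsCauchy s → Converges s

record CompletedAlgebraicClosure {c ℓ : Level} (F : Field c ℓ) : Set (lsuc (c ⊔ ℓ)) where
  field
    K̄ : AlgebraicClosure (laurentSeries F)
  private module K̄ = AlgebraicClosure K̄
  field
    abs         : AbsoluteValue K̄.closure
    abs-extends : ∀ t N → HasOrder F t N → AbsoluteValue.‖_‖ abs (K̄.embed t) ≡ q^- (N / 1)
    K̄c          : Completion K̄.closure abs
  open Completion K̄c public hiding (embed)

  embed : LaurentSeries F → Carrier
  embed t = Completion.embed K̄c (K̄.embed t)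

private
  absorption : ∀ n k → suc k ℕ.* (suc n C suc k) ≡ suc n ℕ.* (n C k)
  absorption zero    zero    = ≡.refl
  absorption zero    (suc k) = ≡.trans
    (≡.cong (suc (suc k) ℕ.*_) (k>n⇒nCk≡0 {suc zero} {suc (suc k)} (s≤s (s≤s z≤n))))
    (≡.trans (ℕₚ.*-zeroʳ k)
      (≡.sym (≡.trans (ℕₚ.+-identityʳ _) (k>n⇒nCk≡0 {zero} {suc k} (s≤s z≤n)))))
  absorption (suc n) zero    = ≡.trans (ℕₚ.+-identityʳ _)
    (≡.trans (nC1≡n (suc (suc n))) (≡.sym (ℕₚ.*-identityʳ (suc (suc n)))))
  absorption (suc n) (suc k) = begin
    suc (suc k) ℕ.* (suc (suc n) C suc (suc k))
      ≡⟨ ≡.cong (suc (suc k) ℕ.*_) (≡.sym (nCk+nC[k+1]≡[n+1]C[k+1] (suc n) (suc k))) ⟩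
    suc (suc k) ℕ.* (A ℕ.+ B)
      ≡⟨ ℕₚ.*-distribˡ-+ (suc (suc k)) A B ⟩
    (A ℕ.+ suc k ℕ.* A) ℕ.+ suc (suc k) ℕ.* B
      ≡⟨ ≡.cong₂ (λ u v → (A ℕ.+ u) ℕ.+ v) (absorption n k) (absorption n (suc k)) ⟩
    (A ℕ.+ suc n ℕ.* (n C k)) ℕ.+ suc n ℕ.* (n C suc k)
      ≡⟨ ℕₚ.+-assoc A _ _ ⟩
    A ℕ.+ (suc n ℕ.* (n C k) ℕ.+ suc n ℕ.* (n C suc k))
      ≡⟨ ≡.cong (A ℕ.+_) (≡.sym (ℕₚ.*-distribˡ-+ (suc n) (n C k) (n C suc k))) ⟩
    A ℕ.+ suc n ℕ.* ((n C k) ℕ.+ (n C suc k))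
      ≡⟨ ≡.cong (λ u → A ℕ.+ suc n ℕ.* u) (nCk+nC[k+1]≡[n+1]C[k+1] n k) ⟩
    suc (suc n) ℕ.* (suc n C suc k) ∎
    where
    open ≡.≡-Reasoning
    A = suc n C suc k
    B = suc n C suc (suc k)

  p∣pCk : ∀ {m k} → Prime (suc m) → k ℕ.< m → suc m ∣ (suc m C suc k)
  p∣pCk {m} {k} pr k<m with euclidsLemma (suc k) (suc m C suc k) pr
                              (≡.subst (suc m ∣_) (≡.sym (absorption m k)) (m∣m*n (m C k)))
  ... | inj₁ p∣k = ⊥-elim (>⇒∤ (s≤s k<m) p∣k)
  ... | inj₂ p∣C = p∣C

module Frobenius {c ℓ : Level} (R : CommutativeRing c ℓ) where
  open CommutativeRing R
  open SemiringMult semiring using (×-congʳ; ×-assocˡ; ×-assoc-*; ×-homo-1)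
    renaming (_×_ to _×ᴺ_)
  open Exp commutativeSemiring using (_^_; ^-congˡ; ^-assocʳ)
  open MonoidSum +-commutativeMonoid using (sum; sum-cong-≋; sum-replicate-zero; sum-init-last)
  private module Bin = Binomial commutativeSemiring
  open SetoidReasoning setoid

  p×≈0 : ∀ {p} → p ×ᴺ 1# ≈ 0# → ∀ z → p ×ᴺ z ≈ 0#
  p×≈0 {p} p≈0 z = begin
    p ×ᴺ z         ≈⟨ ×-congʳ p (*-identityˡ z) ⟨
    p ×ᴺ (1# * z)  ≈⟨ ×-assoc-* p 1# z ⟨
    p ×ᴺ 1# * z    ≈⟨ *-congʳ p≈0 ⟩
    0# * z         ≈⟨ zeroˡ z ⟩
    0#             ∎

  ^p-homo-+ : ∀ {p} → Prime p → p ×ᴺ 1# ≈ 0# → ∀ x y → (x + y) ^ p ≈ x ^ p + y ^ p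
  ^p-homo-+ {zero}        pr _ = ⊥-elim (¬prime[0] pr)
  ^p-homo-+ {suc m} pr p≈0 x y = begin
    (x + y) ^ suc m
      ≈⟨ Bin.theorem (suc m) x y ⟩
    term Fin.zero + sum (term ∘ Fin.suc)
      ≈⟨ +-cong first (sum-init-last (term ∘ Fin.suc)) ⟩
    y ^ suc m + (sum (λ i → term (Fin.suc (inject₁ i))) + term (Fin.suc (fromℕ m)))
      ≈⟨ +-congˡ (+-cong (trans (sum-cong-≋ middle) (sum-replicate-zero m)) last) ⟩
    y ^ suc m + (0# + x ^ suc m)
      ≈⟨ +-congˡ (+-identityˡ _) ⟩
    y ^ suc m + x ^ suc m
      ≈⟨ +-comm _ _ ⟩
    x ^ suc m + y ^ suc m ∎
    where
    term : Fin (suc (suc m)) → Carrier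
    term = Bin.binomialTerm x y (suc m)

    first : term Fin.zero ≈ y ^ suc m
    first = trans (×-homo-1 _) (*-identityˡ _)

    middle : ∀ i → term (Fin.suc (inject₁ i)) ≈ 0#
    middle i rewrite Finₚ.toℕ-inject₁ i with p∣pCk pr (Finₚ.toℕ<n i)
    ... | divides k eq rewrite eq = trans (sym (×-assocˡ _ k (suc m)))
                                   (trans (×-congʳ k (p×≈0 {suc m} p≈0 _)) (n×0 k))
      where
      n×0 : ∀ n → n ×ᴺ 0# ≈ 0#
      n×0 zero    = refl
      n×0 (suc n) = trans (+-identityˡ _) (n×0 n)

    last : term (Fin.suc (fromℕ m)) ≈ x ^ suc m
    last rewrite Finₚ.toℕ-fromℕ m | nCn≡1 (suc m) | ℕₚ.n∸n≡0 m =
      trans (×-homo-1 _) (*-identityʳ _)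

  ^q-homo-+ : ∀ {p} → Prime p → p ×ᴺ 1# ≈ 0# → ∀ e x y →
              (x + y) ^ (p ℕ.^ e) ≈ x ^ (p ℕ.^ e) + y ^ (p ℕ.^ e)
  ^q-homo-+ pr p≈0 zero    x y = trans (*-identityʳ _) (sym (+-cong (*-identityʳ _) (*-identityʳ _)))
  ^q-homo-+ {p} pr p≈0 (suc e) x y = begin
    (x + y) ^ (p ℕ.* p ℕ.^ e)            ≈⟨ ^-assocʳ _ p (p ℕ.^ e) ⟨
    ((x + y) ^ p) ^ (p ℕ.^ e)            ≈⟨ ^-congˡ (p ℕ.^ e) (^p-homo-+ pr p≈0 x y) ⟩
    (x ^ p + y ^ p) ^ (p ℕ.^ e)          ≈⟨ ^q-homo-+ pr p≈0 e _ _ ⟩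
    (x ^ p) ^ (p ℕ.^ e) + (y ^ p) ^ (p ℕ.^ e)
      ≈⟨ +-cong (^-assocʳ x p (p ℕ.^ e)) (^-assocʳ y p (p ℕ.^ e)) ⟩
    x ^ (p ℕ.* p ℕ.^ e) + y ^ (p ℕ.* p ℕ.^ e) ∎

module FiniteFieldCharacteristic {c ℓ : Level} {q : ℕ} (F : FiniteField c ℓ q) where
  open FiniteField F
  open SemiringMult semiring using (×1-homo-*; ×-homo-1) renaming (_×_ to _×ᴺ_)
  open MonoidSum +-commutativeMonoid
    using (sum-cong-≋; sum-replicate; sum-permute; ∑-distrib-+)
  private
    module I = Inverse enumeration
    open GroupProperties +-group using () renaming (identityʳ-unique to +-identityʳ-unique)

    _≟_ : ∀ x y → Dec (x ≈ y)
    x ≟ y = map′ (λ eq → trans (sym (I.strictlyInverseʳ x)) (trans (I.from-cong eq) (I.strictlyInverseʳ y)))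
                 I.to-cong (I.to x Finₚ.≟ I.to y)

    +-cancel : ∀ x y → x + y - y ≈ x
    +-cancel x y = trans (+-assoc x y (- y)) (trans (+-congˡ (-‿inverseʳ y)) (+-identityʳ x))

    +-cancel′ : ∀ x y → x - y + y ≈ x
    +-cancel′ x y = trans (+-assoc x (- y) y) (trans (+-congˡ (-‿inverseˡ y)) (+-identityʳ x))

    translate : Carrier → Fin q → Fin q
    translate a i = I.to (I.from i + a)

    translation : Permutation q q
    translation = permutation (translate 1#) (translate (- 1#))
      (λ i → ≡.trans (I.to-cong (trans (+-congʳ (I.strictlyInverseʳ _)) (+-cancel′ _ _))) (I.strictlyInverseˡ i))
      (λ i → ≡.trans (I.to-cong (trans (+-congʳ (I.strictlyInverseʳ _)) (+-cancel _ _))) (I.strictlyInverseˡ i))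

  q×1≈0 : q ×ᴺ 1# ≈ 0#
  q×1≈0 = trans (sym (sum-replicate q)) (+-identityʳ-unique _ _
    (sym (trans (sum-permute I.from translation)
         (trans (sum-cong-≋ (λ i → I.strictlyInverseʳ (I.from i + 1#)))
                (∑-distrib-+ I.from (λ _ → 1#))))))

  p^n×1≈0⇒p×1≈0 : ∀ p n → (p ℕ.^ n) ×ᴺ 1# ≈ 0# → p ×ᴺ 1# ≈ 0#
  p^n×1≈0⇒p×1≈0 p zero    eq = ⊥-elim (1≉0 (trans (sym (×-homo-1 1#)) eq))
  p^n×1≈0⇒p×1≈0 p (suc n) eq with (p ×ᴺ 1#) ≟ 0#
  ... | yes p≈0 = p≈0
  ... | no  p≉0 = p^n×1≈0⇒p×1≈0 p n (begin
    b                        ≈⟨ *-identityˡ b ⟨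
    1# * b                   ≈⟨ *-congʳ (*-inverseʳ p≉0) ⟨
    a * a ⁻¹ * b             ≈⟨ *-congʳ (*-comm a (a ⁻¹)) ⟩
    a ⁻¹ * a * b             ≈⟨ *-assoc (a ⁻¹) a b ⟩
    a ⁻¹ * (a * b)           ≈⟨ *-congˡ (trans (sym (×1-homo-* p (p ℕ.^ n))) eq) ⟩
    a ⁻¹ * 0#                ≈⟨ zeroʳ _ ⟩
    0#                       ∎)
    where
    open SetoidReasoning setoid
    a = p ×ᴺ 1#
    b = (p ℕ.^ n) ×ᴺ 1#

private
  infixr 8 _×ℚ_
  _×ℚ_ : ℕ → ℚ → ℚ
  zero  ×ℚ r = 0ℚ
  suc n ×ℚ r = r ℚ.+ n ×ℚ r

  ×ℚ-mono-≤ : ∀ n {r s} → r ℚ.≤ s → n ×ℚ r ℚ.≤ n ×ℚ s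
  ×ℚ-mono-≤ zero    r≤s = ℚₚ.≤-refl
  ×ℚ-mono-≤ (suc n) r≤s = ℚₚ.+-mono-≤ r≤s (×ℚ-mono-≤ n r≤s)

  ×ℚ-cancel-≤ : ∀ n {r s} → suc n ×ℚ r ℚ.≤ suc n ×ℚ s → r ℚ.≤ s
  ×ℚ-cancel-≤ n nr≤ns = ℚₚ.≮⇒≥ λ s<r →
    ℚₚ.<-irrefl ≡.refl (ℚₚ.<-≤-trans (ℚₚ.+-mono-<-≤ s<r (×ℚ-mono-≤ n (ℚₚ.<⇒≤ s<r))) nr≤ns)

  0≤n×ℚr : ∀ n {r} → 0ℚ ℚ.≤ r → 0ℚ ℚ.≤ n ×ℚ r
  0≤n×ℚr zero    0≤r = ℚₚ.≤-refl
  0≤n×ℚr (suc n) 0≤r = ℚₚ.+-mono-≤ 0≤r (0≤n×ℚr n 0≤r)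

  r≤n×ℚr : ∀ n {r} → 0ℚ ℚ.≤ r → r ℚ.≤ suc n ×ℚ r
  r≤n×ℚr n {r} 0≤r = ≡.subst (ℚ._≤ suc n ×ℚ r) (ℚₚ.+-identityʳ r) (ℚₚ.+-monoʳ-≤ r (0≤n×ℚr n 0≤r))

  abstract
    fromN : ℕ → ℚ
    fromN n = + n / 1

    toℚᵘ-/1 : ∀ i → ℚ.toℚᵘ (i / 1) ℚᵘ.≃ mkℚᵘ i 0
    toℚᵘ-/1 i = ℚₚ.toℚᵘ-fromℚᵘ (mkℚᵘ i 0)

    fromN-mono : ∀ {m n} → m ℕ.≤ n → fromN m ℚ.≤ fromN n
    fromN-mono {m} {n} m≤n = ℚₚ.toℚᵘ-cancel-≤
      (ℚᵘₚ.≤-respˡ-≃ (ℚᵘₚ.≃-sym (toℚᵘ-/1 (+ m))) (ℚᵘₚ.≤-respʳ-≃ (ℚᵘₚ.≃-sym (toℚᵘ-/1 (+ n)))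
        (ℚᵘ.*≤* (ℤₚ.*-monoʳ-≤-nonNeg (+ 1) (ℤ.+≤+ m≤n)))))

    0≤fromN : ∀ n → 0ℚ ℚ.≤ fromN n
    0≤fromN n = fromN-mono (z≤n {n})

    archimedean : ∀ r → ∃ λ n → r ℚ.≤ fromN n
    archimedean (mkℚ (+ n) d c) = n , ℚₚ.toℚᵘ-cancel-≤
      (ℚᵘₚ.≤-respʳ-≃ (ℚᵘₚ.≃-sym (toℚᵘ-/1 (+ n)))
        (ℚᵘ.*≤* (ℤₚ.*-monoˡ-≤-nonNeg (+ n) (ℤ.+≤+ (s≤s (z≤n {d}))))))
    archimedean (mkℚ -[1+ n ] d c) = 0 , *≤* ℤ.-≤+

  ≼-trans : ∀ {u v w} → u ≼ v → v ≼ w → u ≼ w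
  ≼-trans 0≼       _        = 0≼
  ≼-trans (q^-≼ a) (q^-≼ b) = q^-≼ (ℚₚ.≤-trans b a)

module AbsoluteValueProperties {c ℓ : Level} {L : Field c ℓ} (abs : AbsoluteValue L) where
  open Field L
  open AbsoluteValue abs
  open RingProperties ring using (-‿distribˡ-*; -‿distribʳ-*; -‿involutive)
  private
    power : Value → ℕ → Value
    power v zero    = q^- 0ℚ
    power v (suc n) = v · power v n

    power-q^- : ∀ r n → power (q^- r) n ≡ q^- (n ×ℚ r)
    power-q^- r zero    = ≡.refl
    power-q^- r (suc n) = ≡.cong (q^- r ·_) (power-q^- r n)

    idempotent : ∀ r → r ℚ.+ r ≡ r → r ≡ 0ℚ
    idempotent r = GroupProperties.identityʳ-unique ℚₚ.+-0-group r r

    ‖1‖ : ‖ 1# ‖ ≡ q^- 0ℚ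
    ‖1‖ with ‖ 1# ‖ in eq
    ... | 0ᵛ    = ⊥-elim (1≉0 (‖‖≡0⇒≈0 eq))
    ... | q^- r = ≡.cong q^-_ (idempotent r (q^-injective (≡.trans
                    (≡.sym (≡.trans (‖‖-* 1# 1#) (≡.cong₂ _·_ eq eq)))
                    (≡.trans (‖‖-cong (*-identityˡ 1#)) eq))))
      where
      q^-injective : ∀ {r s} → q^- r ≡ q^- s → r ≡ s
      q^-injective ≡.refl = ≡.refl

    ‖^‖ : ∀ z n → ‖ z ^ n ‖ ≡ power ‖ z ‖ n
    ‖^‖ z zero    = ‖1‖
    ‖^‖ z (suc n) = ≡.trans (‖‖-* z (z ^ n)) (≡.cong (‖ z ‖ ·_) (‖^‖ z n))

    power-mono : ∀ {v r} n → v ≼ q^- r → power v n ≼ q^- (n ×ℚ r)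
    power-mono           zero    _          = q^-≼ ℚₚ.≤-refl
    power-mono           (suc n) 0≼         = 0≼
    power-mono {q^- s} {r} (suc n) (q^-≼ r≤s) rewrite power-q^- s n = q^-≼ (×ℚ-mono-≤ (suc n) r≤s)

    power-cancel : ∀ v {r} n → power v (suc n) ≼ q^- (suc n ×ℚ r) → v ≼ q^- r
    power-cancel 0ᵛ      n _ = 0≼
    power-cancel (q^- s) n le rewrite power-q^- s n with le
    ... | q^-≼ nr≤ns = q^-≼ (×ℚ-cancel-≤ n nr≤ns)

  ^-mono-≼ : ∀ z r n → ‖ z ‖ ≼ q^- r → ‖ z ^ n ‖ ≼ q^- (n ×ℚ r)
  ^-mono-≼ z r n le rewrite ‖^‖ z n = power-mono n le

  ^-cancel-≼ : ∀ z r n → ‖ z ^ suc n ‖ ≼ q^- (suc n ×ℚ r) → ‖ z ‖ ≼ q^- r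
  ^-cancel-≼ z r n le rewrite ‖^‖ z (suc n) = power-cancel ‖ z ‖ n le

  ‖‖-resp : ∀ {x y v} → x ≈ y → ‖ x ‖ ≼ v → ‖ y ‖ ≼ v
  ‖‖-resp x≈y = ≡.subst (_≼ _) (‖‖-cong x≈y)

  ‖-‖ : ∀ z r → ‖ z ‖ ≼ q^- r → ‖ - z ‖ ≼ q^- r
  ‖-‖ z r le = ^-cancel-≼ (- z) r 1 (‖‖-resp square (^-mono-≼ z r 2 le))
    where
    open SetoidReasoning setoid
    square : z ^ 2 ≈ (- z) ^ 2
    square = begin
      z * (z * 1#)        ≈⟨ *-congˡ (*-identityʳ z) ⟩
      z * z               ≈⟨ -‿involutive (z * z) ⟨
      - (- (z * z))       ≈⟨ -‿cong (-‿distribˡ-* z z) ⟩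
      - (- z * z)         ≈⟨ -‿distribʳ-* (- z) z ⟩
      - z * - z           ≈⟨ *-congˡ (*-identityʳ (- z)) ⟨
      - z * (- z * 1#)    ∎

  x-z : ∀ {x y z v} → ‖ x - y ‖ ≼ v → ‖ y - z ‖ ≼ v → ‖ x - z ‖ ≼ v
  x-z {x} {y} {z} a b = ‖‖-resp (begin
    (x - y) + (y - z)     ≈⟨ +-assoc x (- y) (y - z) ⟩
    x + (- y + (y - z))   ≈⟨ +-congˡ (+-assoc (- y) y (- z)) ⟨
    x + (- y + y - z)     ≈⟨ +-congˡ (+-congʳ (-‿inverseˡ y)) ⟩
    x + (0# - z)          ≈⟨ +-congˡ (+-identityˡ (- z)) ⟩
    x - z                 ∎) (ultrametric a b)
    where open SetoidReasoning setoid

  flip : ∀ {x y} r → ‖ x - y ‖ ≼ q^- r → ‖ y - x ‖ ≼ q^- r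
  flip {x} {y} r le = ‖‖-resp (⁻¹-anti-homo-// x y) (‖-‖ (x - y) r le)
    where open GroupProperties +-group using (⁻¹-anti-homo-//)

  small⇒≈0 : ∀ z → (∀ n → ‖ z ‖ ≼ q^- fromN n) → z ≈ 0#
  small⇒≈0 z small with ‖ z ‖ in eq
  ... | 0ᵛ    = ‖‖≡0⇒≈0 eq
  ... | q^- s with archimedean (s ℚ.+ 1ℚ)
  ... | n , s+1≤n with small n
  ... | q^-≼ n≤s = ⊥-elim (ℚₚ.<-irrefl ≡.refl (ℚₚ.<-≤-trans s<s+1 (ℚₚ.≤-trans s+1≤n n≤s)))
    where
    s<s+1 : s ℚ.< s ℚ.+ 1ℚ
    s<s+1 = ≡.subst (ℚ._< s ℚ.+ 1ℚ) (ℚₚ.+-identityʳ s)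
              (ℚₚ.+-monoʳ-< s (ℚₚ.positive⁻¹ 1ℚ))

module QthRoots
  {c ℓ : Level} {p q e : ℕ} (p-prime : Prime p) (q≡p^e : q ≡ p ℕ.^ suc e)
  (F : FiniteField c ℓ q) (Ω : CompletedAlgebraicClosure (FiniteField.𝔽 F)) where

  private
    module F = FiniteField F
    module K = RawRing (laurentSeries F.𝔽)
    module Ω = CompletedAlgebraicClosure Ω
    module K̄ = AlgebraicClosure Ω.K̄
    module ι = RingMorphisms.IsRingMonomorphism K̄.embed-mono
    module κ = RingMorphisms.IsRingHomomorphism (Completion.embed-homo Ω.K̄c)
  open Ω
  open AbsoluteValueProperties absoluteValue
  open SemiringMult F.semiring using () renaming (_×_ to _×F_)
  open SemiringMult semiring using () renaming (_×_ to _×Ω_)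
  open Exp commutativeSemiring using (^-congˡ)
  private
    scalar : F.Carrier → Carrier
    scalar a = embed (x^- 0 · constant F.𝔽 a)

    scalar-cong : ∀ {a b} → a F.≈ b → scalar a ≈ scalar b
    scalar-cong a≈b = κ.⟦⟧-cong (ι.⟦⟧-cong λ { zero → a≈b ; (suc _) → F.refl })

    scalar-+ : ∀ a b → scalar (a F.+ b) ≈ scalar a + scalar b
    scalar-+ a b = trans
      (κ.⟦⟧-cong (K̄.trans
        (ι.⟦⟧-cong {x^- 0 · constant F.𝔽 (a F.+ b)}
                   {(x^- 0 · constant F.𝔽 a) K.+ (x^- 0 · constant F.𝔽 b)}
                   λ { zero → F.refl ; (suc _) → F.sym (F.+-identityˡ F.0#) })
        (ι.+-homo _ _)))
      (κ.+-homo _ _)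

    scalar-× : ∀ n → scalar (n ×F F.1#) ≈ n ×Ω 1#
    scalar-× zero    = trans (κ.⟦⟧-cong ι.0#-homo) κ.0#-homo
    scalar-× (suc n) = trans (scalar-+ F.1# (n ×F F.1#))
      (+-cong (trans (κ.⟦⟧-cong ι.1#-homo) κ.1#-homo) (scalar-× n))

    p×1≈0 : p ×Ω 1# ≈ 0#
    p×1≈0 = trans (sym (scalar-× p)) (trans (scalar-cong p×1≈0-in-F) (scalar-× zero))
      where
      open FiniteFieldCharacteristic F
      p×1≈0-in-F : p ×F F.1# F.≈ F.0#
      p×1≈0-in-F = p^n×1≈0⇒p×1≈0 p (suc e) (≡.subst (λ m → m ×F F.1# F.≈ F.0#) q≡p^e q×1≈0)

    ^q-+ : ∀ x y → (x + y) ^ q ≈ x ^ q + y ^ q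
    ^q-+ = ≡.subst (λ m → ∀ x y → (x + y) ^ m ≈ x ^ m + y ^ m) (≡.sym q≡p^e)
             (Frobenius.^q-homo-+ commutativeRing p-prime p×1≈0 (suc e))

    p^n≢0 : ∀ n → ∃ λ m → p ℕ.^ n ≡ suc m
    p^n≢0 n with p ℕ.^ n in eq
    ... | suc m = m , ≡.refl
    ... | zero  = ⊥-elim (¬prime[0] (≡.subst Prime (ℕₚ.m^n≡0⇒m≡0 p n eq) p-prime))

    abstract
      q-1 : ℕ
      q-1 = proj₁ (p^n≢0 (suc e))

      q≡ : q ≡ suc q-1
      q≡ = ≡.trans q≡p^e (proj₂ (p^n≢0 (suc e)))

    add-sub : ∀ x y → x - y + y ≈ x
    add-sub x y = trans (+-assoc x (- y) y) (trans (+-congˡ (-‿inverseˡ y)) (+-identityʳ x))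

    sub-unique : ∀ {x y z} → x + y ≈ z → x ≈ z - y
    sub-unique {x} {y} {z} eq = trans (sym (trans (+-assoc x y (- y))
      (trans (+-congˡ (-‿inverseʳ y)) (+-identityʳ x)))) (+-congʳ eq)

    ^q-- : ∀ x y → (x - y) ^ q ≈ x ^ q - y ^ q
    ^q-- x y = sub-unique (trans (sym (^q-+ (x - y) y)) (^-congˡ q (add-sub x y)))

    -≈0 : ∀ {x y} → x - y ≈ 0# → x ≈ y
    -≈0 {x} {y} eq = trans (sym (add-sub x y)) (trans (+-congʳ eq) (+-identityˡ y))

    κ^ : ∀ z n → Completion.embed K̄c (z K̄.^ n) ≈ Completion.embed K̄c z ^ n
    κ^ z zero    = κ.1#-homo
    κ^ z (suc n) = trans (κ.*-homo z (z K̄.^ n)) (*-congˡ (κ^ z n))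

    closure-root : ∀ a → ∃ λ z → z K̄.^ q K̄.≈ a
    closure-root a = z , ≡.subst (λ m → z K̄.^ m K̄.≈ a) (≡.sym q≡) (begin
      z K̄.^ suc q-1                              ≈⟨ K̄.+-identityʳ _ ⟨
      z K̄.^ suc q-1 K̄.+ K̄.0#                     ≈⟨ K̄.+-congˡ (K̄.-‿inverseˡ a) ⟨
      z K̄.^ suc q-1 K̄.+ (K̄.- a K̄.+ a)            ≈⟨ K̄.+-assoc _ _ _ ⟨
      z K̄.^ suc q-1 K̄.+ K̄.- a K̄.+ a              ≈⟨ K̄.+-congʳ (K̄.+-congˡ constant-term) ⟨
      monic K̄.closure coeffs z K̄.+ a             ≈⟨ K̄.+-congʳ (proj₂ solution) ⟩
      K̄.0# K̄.+ a                                 ≈⟨ K̄.+-identityˡ a ⟩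
      a                                          ∎)
      where
      open SetoidReasoning K̄.setoid
      open MonoidSum K̄.+-commutativeMonoid using (sum-cong-≋; sum-replicate-zero)
      coeffs : Fin (suc q-1) → K̄.Carrier
      coeffs Fin.zero    = K̄.- a
      coeffs (Fin.suc _) = K̄.0#
      solution = K̄.algebraicallyClosed q-1 coeffs
      z = proj₁ solution
      constant-term : K̄.sum (λ i → coeffs i K̄.* z K̄.^ toℕ i) K̄.≈ K̄.- a
      constant-term = K̄.trans
        (K̄.+-cong (K̄.*-identityʳ (K̄.- a))
          (K̄.trans (sum-cong-≋ {q-1} (λ i → K̄.zeroˡ (z K̄.^ suc (toℕ i)))) (sum-replicate-zero q-1)))
        (K̄.+-identityʳ (K̄.- a))

  ^q-injective : ∀ {x y} → x ^ q ≈ y ^ q → x ≈ y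
  ^q-injective {x} {y} eq = -≈0 (small⇒≈0 (x - y) λ n →
    ^-cancel-≼ (x - y) (fromN n) q-1 (≡.subst (λ m → ‖ (x - y) ^ m ‖ ≼ q^- (suc q-1 ×ℚ fromN n)) q≡
      (‖‖-resp (sym (trans (^q-- x y) (trans (+-congʳ eq) (-‿inverseʳ (y ^ q)))))
        (≡.subst (_≼ q^- (suc q-1 ×ℚ fromN n)) (≡.sym ‖0‖) 0≼))))

  private
    module Approximation (z : Carrier) where
      precision : ℕ → ℚ
      precision n = suc q-1 ×ℚ fromN n

      a : ℕ → K̄.Carrier
      a n = proj₁ (dense z (precision n))

      α : ℕ → Carrier
      α n = Completion.embed K̄c (a n)

      α-close : ∀ {N n} → N ℕ.≤ n → ‖ α n - z ‖ ≼ q^- precision N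
      α-close {N} {n} N≤n = ≼-trans (proj₂ (dense z (precision n)))
        (q^-≼ (×ℚ-mono-≤ (suc q-1) (fromN-mono N≤n)))

      β : ℕ → Carrier
      β n = Completion.embed K̄c (proj₁ (closure-root (a n)))

      β^q : ∀ n → β n ^ q ≈ α n
      β^q n = trans (sym (κ^ (proj₁ (closure-root (a n))) q)) (κ.⟦⟧-cong (proj₂ (closure-root (a n))))

      β-cauchy : IsCauchy β
      β-cauchy r with archimedean r
      ... | N , r≤N = N , λ m n N≤m N≤n → ≼-trans
        (^-cancel-≼ (β m - β n) (fromN N) q-1 (≡.subst (λ k → ‖ (β m - β n) ^ k ‖ ≼ q^- precision N) q≡
          (‖‖-resp (sym (trans (^q-- (β m) (β n)) (+-cong (β^q m) (-‿cong (β^q n)))))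
            (x-z (α-close N≤m) (flip (precision N) (α-close N≤n))))))
        (q^-≼ r≤N)

      limit : Converges β
      limit = complete β β-cauchy

      w : Carrier
      w = proj₁ limit

      w^q≈z : w ^ q ≈ z
      w^q≈z = -≈0 (small⇒≈0 (w ^ q - z) λ N →
        ≼-trans (close N) (q^-≼ (r≤n×ℚr q-1 (0≤fromN N))))
        where
        close : ∀ N → ‖ w ^ q - z ‖ ≼ q^- precision N
        close N with proj₂ limit (fromN N)
        ... | M , βₙ→w = x-z {y = β n ^ q}
          (flip (precision N) (‖‖-resp (^q-- (β n) w) (≡.subst (λ k → ‖ (β n - w) ^ k ‖ ≼ q^- precision N) (≡.sym q≡)
            (^-mono-≼ (β n - w) (fromN N) (suc q-1) (βₙ→w n (ℕₚ.m≤m⊔n M N))))))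
          (‖‖-resp (+-congʳ (sym (β^q n))) (α-close (ℕₚ.m≤n⊔m M N)))
          where n = M ℕ.⊔ N

  abstract
    infix 9 _^1/q
    _^1/q : Carrier → Carrier
    z ^1/q = Approximation.w z

    ^1/q-^q : ∀ z → z ^1/q ^ q ≈ z
    ^1/q-^q z = Approximation.w^q≈z z

module Carlitz
  {c ℓ : Level} {p q e : ℕ} (p-prime : Prime p) (q≡p^e : q ≡ p ℕ.^ suc e)
  (F : FiniteField c ℓ q) (Ω : CompletedAlgebraicClosure (FiniteField.𝔽 F)) where

  private module F = FiniteField F
  open CompletedAlgebraicClosure Ω
  open QthRoots {e = e} p-prime q≡p^e F Ω public using (_^1/q; ^1/q-^q; ^q-injective)

  series : PowerSeries F.𝔽 → Carrier
  series t = embed (x^- 0 · t)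

  x : Carrier
  x = series (multiplyByX^ F.𝔽 1 (constant F.𝔽 F.1#))

  -- x^q^ j is x raised to the power q^j; roots are unique by ^q-injective.
  x^q^_ : ℤ → Carrier
  x^q^ (+ j)        = x ^ (q ℕ.^ j)
  x^q^ -[1+ zero ]  = x ^1/q
  x^q^ -[1+ suc j ] = (x^q^ -[1+ j ]) ^1/q

  [_] : ℤ → Carrier
  [ j ] = x^q^ j - x

  productL : List Carrier → Carrier
  productL = List.foldr _*_ 1#

  -- D i = [i] [i-1]^q ⋯ [1]^{q^{i-1}}
  D : ℕ → Carrier
  D i = productL (applyUpTo (λ j → [ + (i ∸ j) ] ^ (q ℕ.^ j)) i)

  -- a₀ ∷ a₁ ∷ ⋯ ∷ [] stands for a₀ + a₁ x + ⋯; trailing zeros are allowed.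
  Polynomial : Set c
  Polynomial = List F.Carrier

  polynomial : Polynomial → PowerSeries F.𝔽
  polynomial []       _       = F.0#
  polynomial (a ∷ _)  zero    = a
  polynomial (_ ∷ as) (suc n) = polynomial as n

  polynomialsOfDegree< : ℕ → List Polynomial
  polynomialsOfDegree< zero    = [] ∷ []
  polynomialsOfDegree< (suc i) = cartesianProductWith _∷_ F.elements (polynomialsOfDegree< i)

  carlitzE : ℕ → Carrier → Carrier
  carlitzE zero    t = t
  carlitzE (suc i) t =
    productL (List.map (λ ω → t - series (polynomial ω)) (polynomialsOfDegree< (suc i)))

  carlitzF : ℕ → Carrier → Carrier
  carlitzF i t = D i ⁻¹ * carlitzE i t

  partialSum : (ℕ → Carrier) → PowerSeries F.𝔽 → ℕ → Carrier
  partialSum c t n = sum {n} (λ i → c (toℕ i) * carlitzF (toℕ i) (series t))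

  -- The value of Σ cᵢ fᵢ at a polynomial ω: the terms with deg ω < i vanish.
  sumOnPolynomials : (ℕ → Carrier) → Polynomial → Carrier
  sumOnPolynomials c ω = partialSum c (polynomial ω) (List.length ω)

  Δ : (Polynomial → Carrier) → Polynomial → Carrier
  Δ u ω = u (F.0# ∷ ω) - x * u ω

  Δ-_ : Carrier → (Polynomial → Carrier) → Polynomial → Carrier
  (Δ- μ) u ω = Δ u ω - μ * u ω

  d : (Polynomial → Carrier) → Polynomial → Carrier
  d u ω = Δ u ω ^1/q

  SolvesEquation : (a b : ℤ) → (Polynomial → Carrier) → Set (c ⊔ ℓ)
  SolvesEquation a b u =
    ∀ ω → (Δ- [ ℤ.- a ]) ((Δ- [ ℤ.- b ]) u) ω ≈ d (Δ u) ω

  SolvesRecursion : (a b : ℤ) → (ℕ → Carrier) → Set ℓ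
  SolvesRecursion a b c = ∀ i →
    (c (2 ℕ.+ i) ^1/q - c (2 ℕ.+ i))
      + c (1 ℕ.+ i) ^1/q * [ + (1 ℕ.+ i) ] ^1/q
      - c (1 ℕ.+ i) * ([ + i ] + [ + (1 ℕ.+ i) ] - [ ℤ.- a ] - [ ℤ.- b ])
      - c i * ([ + i ] - [ ℤ.- a ]) * ([ + i ] - [ ℤ.- b ])
    ≈ 0#

  -- That c n is a root of its equation z^{1/q} - z = v is expressed by SolvesRecursion.
  IsGeneric : (ℕ → Carrier) → Set
  IsGeneric c = ∃ λ N → ∀ n → N ℕ.≤ n → ‖ c n ‖ ≡ q^- 0ℚ

  IsStronglySingular : (ℕ → Carrier) → Set (c ⊔ ℓ)
  IsStronglySingular c = ∀ t → ¬ IsPolynomial F.𝔽 t → ¬ Converges (partialSum c t)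

{-# OPTIONS --safe #-}

-- It suffices that |fₙ(t)| = 1 whenever the coefficient tₙ of xⁿ in t is non-zero:
-- then |cₙ fₙ(t)| = 1 for infinitely many n unless t is a polynomial. If tₙ ≠ 0,
-- then every ω of degree < n satisfies |t - ω| = q^{-v} with v ≤ n the first index
-- at which t and ω differ. For each m ≤ n exactly q^{n-m} of the ω have v ≥ m, so
-- |eₙ(t)| = q^{-(1 + q + ⋯ + q^{n-1})}, which is |Dₙ| because |[i]| = q^{-1} for i ≥ 1.
module Submission where

open import Defs
open import Level using (Level)
open import Data.Nat.Base using (ℕ; suc; _^_)
open import Data.Nat.Primality using (Prime)
open import Data.Integer.Base using (ℤ)
open import Data.Sum.Base using (_⊎_)
open import Relation.Binary.PropositionalEquality.Core using (_≡_)

open import Algebra.Morphism.Structures using (module RingMorphisms)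
import Algebra.Properties.CommutativeSemigroup as CommutativeSemigroupProperties
import Algebra.Properties.Group as GroupProperties
open import Data.Nat.Base as ℕ using (zero; z≤n; s≤s; _∸_; _<_; _≤_; _⊔_)
import Data.Nat.Properties as ℕₚ
open import Data.Nat.ListAction using (sum)
open import Data.Nat.ListAction.Properties using (sum-++)
open import Data.Nat.Primality using (prime⇒nonTrivial)
open import Data.Integer.Base as ℤ using (+_)
import Data.Integer.Properties as ℤₚ
open import Data.Rational.Base as ℚ using (_/_)
import Data.Rational.Properties as ℚₚ
open import Data.Rational.Unnormalised.Base as ℚᵘ using (mkℚᵘ)
import Data.Rational.Unnormalised.Properties as ℚᵘₚ
open import Data.Fin.Base as Fin using (Fin; toℕ)
import Data.Fin.Properties as Finₚ
open import Data.List.Base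
  using (List; []; _∷_; _++_; _∷ʳ_; map; length; upTo; tabulate; allFin; cartesianProductWith)
import Data.List.Properties as Listₚ
open import Data.List.Relation.Unary.All as All using (All; []; _∷_)
import Data.List.Relation.Unary.All.Properties as Allₚ
open import Data.Product.Base using (_,_)
open import Data.Sum.Base using (inj₁; inj₂)
open import Data.Empty using (⊥-elim)
open import Function.Base using (_∘_; id)
open import Function.Bundles using (Inverse)
open import Function.Properties.Inverse using (Inverse⇒Injection)
open import Relation.Binary.Definitions using (Decidable)
open import Relation.Binary.PropositionalEquality.Core as ≡ using (_≢_)
import Relation.Binary.PropositionalEquality.Properties as ≡
import Relation.Binary.Reasoning.Setoid as SetoidReasoning
open import Relation.Nullary using (¬_; yes; no; contradiction)
open import Relation.Nullary.Decidable using (via-injection)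

-- Integers as rational exponents.

toℚᵘ-/1 : ∀ i → ℚ.toℚᵘ (i / 1) ℚᵘ.≃ mkℚᵘ i 0
toℚᵘ-/1 i = ℚₚ.toℚᵘ-fromℚᵘ (mkℚᵘ i 0)

-- Addition in `ℚ` normalises fractions, so the identity is checked on unnormalised rationals, where
-- it is integer arithmetic.
/1-homo-+ : ∀ i j → i / 1 ℚ.+ j / 1 ≡ (i ℤ.+ j) / 1
/1-homo-+ i j = ℚₚ.toℚᵘ-injective (begin
  ℚ.toℚᵘ (i / 1 ℚ.+ j / 1)               ≈⟨ ℚₚ.toℚᵘ-homo-+ (i / 1) (j / 1) ⟩
  ℚ.toℚᵘ (i / 1) ℚᵘ.+ ℚ.toℚᵘ (j / 1)     ≈⟨ ℚᵘₚ.+-cong (toℚᵘ-/1 i) (toℚᵘ-/1 j) ⟩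
  mkℚᵘ i 0 ℚᵘ.+ mkℚᵘ j 0                 ≈⟨ ℚᵘ.*≡* (≡.cong (ℤ._* + 1) (≡.cong₂ ℤ._+_ (ℤₚ.*-identityʳ i) (ℤₚ.*-identityʳ j))) ⟩
  mkℚᵘ (i ℤ.+ j) 0                       ≈⟨ toℚᵘ-/1 (i ℤ.+ j) ⟨
  ℚ.toℚᵘ ((i ℤ.+ j) / 1)                 ∎)
  where open ℚᵘₚ.≃-Reasoning

/1-mono-< : ∀ {i j} → i ℤ.< j → i / 1 ℚ.< j / 1
/1-mono-< {i} {j} i<j = ℚₚ.toℚᵘ-cancel-<
  (ℚᵘₚ.<-respˡ-≃ (ℚᵘₚ.≃-sym (toℚᵘ-/1 i)) (ℚᵘₚ.<-respʳ-≃ (ℚᵘₚ.≃-sym (toℚᵘ-/1 j))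
    (ℚᵘ.*<* (ℤₚ.*-monoʳ-<-pos (+ 1) i<j))))

<⇒≱ : ∀ {r s} → r ℚ.< s → ¬ s ℚ.≤ r
<⇒≱ r<s s≤r = ℚₚ.<-irrefl ≡.refl (ℚₚ.<-≤-trans r<s s≤r)

-- Finite sums of natural numbers.

sum-map-cartesianProductWith :
  ∀ {a b c} {A : Set a} {B : Set b} {C : Set c} (g : C → ℕ) (f : A → B → C) xs ys →
  sum (map g (cartesianProductWith f xs ys)) ≡ sum (map (λ x → sum (map (g ∘ f x) ys)) xs)
sum-map-cartesianProductWith g f []       ys = ≡.refl
sum-map-cartesianProductWith g f (x ∷ xs) ys = begin
  sum (map g (map (f x) ys ++ zs))              ≡⟨ ≡.cong sum (Listₚ.map-++ g (map (f x) ys) zs) ⟩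
  sum (map g (map (f x) ys) ++ map g zs)        ≡⟨ sum-++ (map g (map (f x) ys)) (map g zs) ⟩
  sum (map g (map (f x) ys)) ℕ.+ sum (map g zs) ≡⟨ ≡.cong₂ ℕ._+_ (≡.cong sum (≡.sym (Listₚ.map-∘ ys)))
                                                     (sum-map-cartesianProductWith g f xs ys) ⟩
  sum (map (λ x → sum (map (g ∘ f x) ys)) (x ∷ xs)) ∎
  where
  open ≡.≡-Reasoning
  zs = cartesianProductWith f xs ys

length-cartesianProductWith :
  ∀ {a b c} {A : Set a} {B : Set b} {C : Set c} (f : A → B → C) xs ys →
  length (cartesianProductWith f xs ys) ≡ length xs ℕ.* length ys
length-cartesianProductWith f []       ys = ≡.refl
length-cartesianProductWith f (x ∷ xs) ys = ≡.trans (Listₚ.length-++ (map (f x) ys))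
  (≡.cong₂ ℕ._+_ (Listₚ.length-map (f x) ys) (length-cartesianProductWith f xs ys))

sum-map-0 : ∀ {a} {A : Set a} (xs : List A) → sum (map (λ _ → 0) xs) ≡ 0
sum-map-0 []       = ≡.refl
sum-map-0 (_ ∷ xs) = sum-map-0 xs

sum-map-suc : ∀ {a} {A : Set a} (g : A → ℕ) xs →
              sum (map (suc ∘ g) xs) ≡ length xs ℕ.+ sum (map g xs)
sum-map-suc g []       = ≡.refl
sum-map-suc g (x ∷ xs) = ≡.cong suc (begin
  g x ℕ.+ sum (map (suc ∘ g) xs)           ≡⟨ ≡.cong (g x ℕ.+_) (sum-map-suc g xs) ⟩
  g x ℕ.+ (length xs ℕ.+ sum (map g xs))   ≡⟨ ℕₚ.+-assoc (g x) (length xs) _ ⟨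
  g x ℕ.+ length xs ℕ.+ sum (map g xs)     ≡⟨ ≡.cong (ℕ._+ sum (map g xs)) (ℕₚ.+-comm (g x) (length xs)) ⟩
  length xs ℕ.+ g x ℕ.+ sum (map g xs)     ≡⟨ ℕₚ.+-assoc (length xs) (g x) _ ⟩
  length xs ℕ.+ (g x ℕ.+ sum (map g xs))   ∎)
  where open ≡.≡-Reasoning

sum-tabulate-0 : ∀ {n} {f : Fin n → ℕ} → (∀ i → f i ≡ 0) → sum (tabulate f) ≡ 0
sum-tabulate-0 {zero}  f≡0 = ≡.refl
sum-tabulate-0 {suc n} f≡0 = ≡.cong₂ ℕ._+_ (f≡0 Fin.zero) (sum-tabulate-0 (f≡0 ∘ Fin.suc))

sum-tabulate-single : ∀ {n} {f : Fin n → ℕ} j → (∀ i → i ≢ j → f i ≡ 0) → sum (tabulate f) ≡ f j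
sum-tabulate-single {f = f} Fin.zero    f≡0 =
  ≡.trans (≡.cong (f Fin.zero ℕ.+_) (sum-tabulate-0 (λ i → f≡0 (Fin.suc i) λ ()))) (ℕₚ.+-identityʳ _)
sum-tabulate-single {f = f} (Fin.suc j) f≡0 = ≡.cong₂ ℕ._+_ (f≡0 Fin.zero λ ())
  (sum-tabulate-single j λ i i≢j → f≡0 (Fin.suc i) (i≢j ∘ Finₚ.suc-injective))


-- Values with natural exponents.

q^-ℕ_ : ℕ → Value
q^-ℕ n = q^- (+ n / 1)

·-homo-+ : ∀ m n → q^-ℕ m · q^-ℕ n ≡ q^-ℕ (m ℕ.+ n)
·-homo-+ m n = ≡.cong q^-_ (/1-homo-+ (+ m) (+ n))

q^-≼⁻¹ : ∀ {r s} → q^- r ≼ q^- s → s ℚ.≤ r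
q^-≼⁻¹ (q^-≼ s≤r) = s≤r

≼-trans : ∀ {u v w} → u ≼ v → v ≼ w → u ≼ w
≼-trans 0≼       _        = 0≼
≼-trans (q^-≼ a) (q^-≼ b) = q^-≼ (ℚₚ.≤-trans b a)

module _
  {ℓ₁ ℓ₂ : Level} {p q e : ℕ} (p-prime : Prime p) (q≡p^e : q ≡ p ^ suc e)
  (F : FiniteField ℓ₁ ℓ₂ q) (Ω : CompletedAlgebraicClosure (FiniteField.𝔽 F)) where

  private
    module F = FiniteField F
    module Ω = CompletedAlgebraicClosure Ω
    module K̄ = AlgebraicClosure Ω.K̄
    module ι = RingMorphisms.IsRingMonomorphism K̄.embed-mono
    module κ = RingMorphisms.IsRingHomomorphism (Completion.embed-homo Ω.K̄c)
    module I = Inverse F.enumeration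
    module FG = GroupProperties F.+-group
  open Ω hiding (sum) renaming (_^_ to _^ᶠ_)
  open AbsoluteValueProperties absoluteValue
  open Carlitz {e = e} p-prime q≡p^e F Ω
  open GroupProperties +-group using (//-rightDividesˡ; //-rightDividesʳ)

  -- Coefficients are compared through their indices in the enumeration. This makes `order`
  -- computable and allows vanishing of a coefficient to be proved by contradiction.
  _≟_ : Decidable F._≈_
  _≟_ = via-injection (Inverse⇒Injection F.enumeration) Finₚ._≟_

  -- The ultrametric inequality for unequal values.

  -- Otherwise `b = (b - a) + a` would have value at most `q^- s`, which is strictly below `q^- r`.
  ‖-‖-not-below : ∀ {a b r s} → r ℚ.< s → ‖ b ‖ ≡ q^- r → ‖ a ‖ ≼ q^- s → ¬ ‖ a - b ‖ ≼ q^- s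
  ‖-‖-not-below {a} {b} {r} {s} r<s ‖b‖≡r ‖a‖≼s ‖a-b‖≼s =
    <⇒≱ r<s (q^-≼⁻¹ (≡.subst (_≼ q^- s) ‖b‖≡r
      (‖‖-resp (//-rightDividesˡ a b) (ultrametric (flip s ‖a-b‖≼s) ‖a‖≼s))))

  ‖-‖-dominant : ∀ {a b r s} → r ℚ.< s → ‖ b ‖ ≡ q^- r → ‖ a ‖ ≼ q^- s → ‖ a - b ‖ ≡ q^- r
  ‖-‖-dominant {a} {b} {r} {s} r<s ‖b‖≡r ‖a‖≼s = helper ‖ a - b ‖ ≡.refl
    where
    ‖a-b‖≼r : ‖ a - b ‖ ≼ q^- r
    ‖a-b‖≼r = ultrametric (≼-trans ‖a‖≼s (q^-≼ (ℚₚ.<⇒≤ r<s)))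
      (‖-‖ b r (≡.subst (_≼ q^- r) (≡.sym ‖b‖≡r) (q^-≼ ℚₚ.≤-refl)))

    helper : ∀ v → ‖ a - b ‖ ≡ v → ‖ a - b ‖ ≡ q^- r
    helper 0ᵛ eq = contradiction (≡.subst (_≼ q^- s) (≡.sym eq) 0≼) (‖-‖-not-below r<s ‖b‖≡r ‖a‖≼s)
    helper (q^- u) eq = ≡.trans eq (≡.cong q^-_ (ℚₚ.≤-antisym (ℚₚ.≮⇒≥ r≮u) r≤u))
      where
      r≤u : r ℚ.≤ u
      r≤u = q^-≼⁻¹ (≡.subst (_≼ q^- r) eq ‖a-b‖≼r)

      r≮u : ¬ r ℚ.< u
      r≮u r<u with ℚₚ.≤-total u s
      -- With `r < u`, both `a` and `a - b` are bounded by the larger of `q^- u` and `q^- s`, which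
      -- is still below the value of `b`.
      ... | inj₁ u≤s = ‖-‖-not-below r<u ‖b‖≡r (≼-trans ‖a‖≼s (q^-≼ u≤s))
                         (≡.subst (_≼ q^- u) (≡.sym eq) (q^-≼ ℚₚ.≤-refl))
      ... | inj₂ s≤u = ‖-‖-not-below r<s ‖b‖≡r ‖a‖≼s
                         (≡.subst (_≼ q^- s) (≡.sym eq) (q^-≼ s≤u))

  -- Absolute values of power series.

  ‖series‖ : ∀ s k → ¬ s k F.≈ F.0# → (∀ j → j < k → s j F.≈ F.0#) → ‖ series s ‖ ≡ q^-ℕ k
  ‖series‖ s k sₖ≉0 s<k≈0 = ≡.trans (embed-isometry (K̄.embed (x^- 0 · s)))
    (≡.trans (abs-extends (x^- 0 · s) (+ k ℤ.- + 0) (k , ≡.refl , sₖ≉0 , s<k≈0))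
             (≡.cong (λ i → q^- (i / 1)) (ℤₚ.+-identityʳ (+ k))))

  -- Both poles are 0, so the shifts in the sum of Laurent series disappear by computation and
  -- subtraction is coefficientwise.
  series-homo-- : ∀ s t → series s - series t ≈ series (λ k → s k F.- t k)
  series-homo-- s t = sym (trans
    (κ.⟦⟧-cong (K̄.trans
      (ι.+-homo (x^- 0 · s) (x^- 0 · λ k → F.- t k))
      (K̄.+-congˡ (ι.-‿homo (x^- 0 · t)))))
    (trans (κ.+-homo _ _) (+-congˡ (κ.-‿homo _))))

  ‖1‖ : ‖ 1# ‖ ≡ q^-ℕ 0
  ‖1‖ = ≡.trans (‖‖-cong (sym (trans (κ.⟦⟧-cong ι.1#-homo) κ.1#-homo)))
    (‖series‖ (constant F.𝔽 F.1#) 0 F.1≉0 λ _ ())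

  ‖x‖ : ‖ x ‖ ≡ q^-ℕ 1
  ‖x‖ = ‖series‖ _ 1 F.1≉0 λ { zero _ → F.refl ; (suc _) (s≤s ()) }

  ‖^‖ : ∀ {z} → ‖ z ‖ ≡ q^-ℕ 1 → ∀ n → ‖ z ^ᶠ n ‖ ≡ q^-ℕ n
  ‖^‖     ‖z‖≡1 zero    = ‖1‖
  ‖^‖ {z} ‖z‖≡1 (suc n) = ≡.trans (‖‖-* z (z ^ᶠ n))
    (≡.trans (≡.cong₂ _·_ ‖z‖≡1 (‖^‖ ‖z‖≡1 n)) (·-homo-+ 1 n))

  -- Absolute values of `[ i ]` and `D`.

  1<q^ : ∀ n → 1 < q ^ suc n
  1<q^ n = ℕₚ.^-monoʳ-< q 1<q (s≤s (z≤n {n}))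
    where
    1<q : 1 < q
    1<q = ≡.subst (1 <_) (≡.sym q≡p^e)
      (ℕₚ.^-monoʳ-< p (ℕ.nonTrivial⇒n>1 p {{prime⇒nonTrivial p-prime}}) (s≤s (z≤n {e})))

  -- The term `x` dominates its power, because `q ^ n` exceeds 1 for positive `n`.
  ‖[]‖ : ∀ n → 0 < n → ‖ [ + n ] ‖ ≡ q^-ℕ 1
  ‖[]‖ (suc n) _ = ‖-‖-dominant (/1-mono-< (ℤ.+<+ (1<q^ n))) ‖x‖
    (≡.subst (_≼ q^-ℕ (q ^ suc n)) (≡.sym (‖^‖ ‖x‖ (q ^ suc n))) (q^-≼ ℚₚ.≤-refl))

  -- Products become sums of exponents; this serves both `D` and `carlitzE`.
  ‖productL‖ : ∀ {a} {A : Set a} (g : A → Carrier) (o : A → ℕ) {ys} →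
               All (λ y → ‖ g y ‖ ≡ q^-ℕ o y) ys → ‖ productL (map g ys) ‖ ≡ q^-ℕ sum (map o ys)
  ‖productL‖ g o []                    = ‖1‖
  ‖productL‖ g o (_∷_ {y} {ys} eq eqs) = ≡.trans (‖‖-* (g y) (productL (map g ys)))
    (≡.trans (≡.cong₂ _·_ eq (‖productL‖ g o eqs)) (·-homo-+ (o y) (sum (map o ys))))

  orderD : ℕ → ℕ
  orderD n = sum (map (q ^_) (upTo n))

  -- The top power is split off, although `upTo` unfolds from the bottom, to match the induction in
  -- `sum-order`.
  orderD-suc : ∀ n → orderD (suc n) ≡ q ^ n ℕ.+ orderD n
  orderD-suc n = begin
    sum (map (q ^_) (upTo (suc n)))       ≡⟨ ≡.cong (sum ∘ map (q ^_)) (Listₚ.upTo-∷ʳ n) ⟨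
    sum (map (q ^_) (upTo n ∷ʳ n))        ≡⟨ ≡.cong sum (Listₚ.map-++ (q ^_) (upTo n) (n ∷ [])) ⟩
    sum (map (q ^_) (upTo n) ∷ʳ (q ^ n))  ≡⟨ sum-++ (map (q ^_) (upTo n)) (q ^ n ∷ []) ⟩
    orderD n ℕ.+ (q ^ n ℕ.+ 0)            ≡⟨ ≡.cong (orderD n ℕ.+_) (ℕₚ.+-identityʳ (q ^ n)) ⟩
    orderD n ℕ.+ q ^ n                    ≡⟨ ℕₚ.+-comm (orderD n) (q ^ n) ⟩
    q ^ n ℕ.+ orderD n                    ∎
    where open ≡.≡-Reasoning

  ‖D‖ : ∀ n → ‖ D n ‖ ≡ q^-ℕ orderD n
  ‖D‖ n = ≡.trans
    (≡.cong (‖_‖ ∘ productL) (≡.sym (Listₚ.map-upTo (λ j → [ + (n ∸ j) ] ^ᶠ (q ^ j)) n)))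
    (‖productL‖ _ (q ^_)
      -- The bound `j < n` keeps the index `n ∸ j` positive, so the base of each factor has value
      -- `q^-ℕ 1` and only the exponent `q ^ j` counts.
      (Allₚ.applyUpTo⁺₁ id n λ {j} j<n → ‖^‖ (‖[]‖ (n ∸ j) (ℕₚ.m<n⇒0<n∸m j<n)) (q ^ j)))

  D≉0 : ∀ n → D n ≉ 0#
  D≉0 n Dₙ≈0 with ≡.trans (≡.sym (‖D‖ n)) (≡.trans (‖‖-cong Dₙ≈0) ‖0‖)
  ... | ()

  -- Polynomials of bounded degree and their agreement with a series.

  length-elements : length F.elements ≡ q
  length-elements = ≡.trans (Listₚ.length-map I.from (allFin q)) (Listₚ.length-tabulate id)

  length-polynomialsOfDegree< : ∀ n → length (polynomialsOfDegree< n) ≡ q ^ n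
  length-polynomialsOfDegree< zero    = ≡.refl
  length-polynomialsOfDegree< (suc n) = ≡.trans
    (length-cartesianProductWith _∷_ F.elements (polynomialsOfDegree< n))
    (≡.cong₂ ℕ._*_ length-elements (length-polynomialsOfDegree< n))

  -- Trailing zeros are kept in the lists, so the one hypothesis that coefficient `n` of `t` is
  -- non-zero applies to every `ω` at index `length ω`.
  all-length : ∀ n → All (λ ω → length ω ≡ n) (polynomialsOfDegree< n)
  all-length zero    = ≡.refl ∷ []
  all-length (suc n) = Allₚ.cartesianProductWith⁺ (≡.setoid _) (≡.setoid _) _∷_ F.elements _
    λ _ ω∈ → ≡.cong suc (All.lookup (all-length n) ω∈)

  -- The first index below length ω at which t and ω differ, and length ω if there is none.
  order : PowerSeries F.𝔽 → Polynomial → ℕ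
  order t []      = 0
  order t (a ∷ ω) with t 0 ≟ a
  ... | yes _ = suc (order (t ∘ suc) ω)
  ... | no  _ = 0

  order-≈ : ∀ t a ω → t 0 F.≈ a → order t (a ∷ ω) ≡ suc (order (t ∘ suc) ω)
  order-≈ t a ω t₀≈a with t 0 ≟ a
  ... | yes _    = ≡.refl
  ... | no  t₀≉a = contradiction t₀≈a t₀≉a

  order-≉ : ∀ t a ω → ¬ t 0 F.≈ a → order t (a ∷ ω) ≡ 0
  order-≉ t a ω t₀≉a with t 0 ≟ a
  ... | yes t₀≈a = contradiction t₀≈a t₀≉a
  ... | no  _    = ≡.refl

  order-agree : ∀ t ω j → j < order t ω → t j F.- polynomial ω j F.≈ F.0#
  order-agree t (a ∷ ω) j j<o with t 0 ≟ a
  order-agree t (a ∷ ω) zero    _         | yes t₀≈a = F.trans (F.+-congʳ t₀≈a) (F.-‿inverseʳ a)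
  order-agree t (a ∷ ω) (suc j) (s≤s j<o) | yes _    = order-agree (t ∘ suc) ω j j<o

  -- If `t` and `ω` agree on the whole list, the order is `length ω`; there the polynomial has
  -- coefficient 0 while `t` does not, so this case also yields a difference.
  order-differ : ∀ t ω → ¬ t (length ω) F.≈ F.0# →
                 ¬ t (order t ω) F.- polynomial ω (order t ω) F.≈ F.0#
  order-differ t []      t₀≉0 t₀-0≈0 = t₀≉0 (FG.x∙y⁻¹≈ε⇒x≈y (t 0) F.0# t₀-0≈0)
  order-differ t (a ∷ ω) tₙ≉0 with t 0 ≟ a
  ... | yes _    = order-differ (t ∘ suc) ω tₙ≉0
  ... | no  t₀≉a = t₀≉a ∘ FG.x∙y⁻¹≈ε⇒x≈y (t 0) a

  ‖series-polynomial‖ : ∀ t ω → ¬ t (length ω) F.≈ F.0# →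
                        ‖ series t - series (polynomial ω) ‖ ≡ q^-ℕ order t ω
  ‖series-polynomial‖ t ω tₙ≉0 = ≡.trans (‖‖-cong (series-homo-- t (polynomial ω)))
    (‖series‖ _ (order t ω) (order-differ t ω tₙ≉0) (order-agree t ω))

  -- Induction on the constant coefficient: a mismatch with `t 0` contributes 0, and for the single
  -- matching element each of the `q ^ n` tails contributes one plus its order against the shifted
  -- series.
  sum-order : ∀ n t → sum (map (order t) (polynomialsOfDegree< n)) ≡ orderD n
  sum-order zero    t = ≡.refl
  sum-order (suc n) t = begin
    sum (map (order t) (cartesianProductWith _∷_ F.elements P))
      ≡⟨ sum-map-cartesianProductWith (order t) _∷_ F.elements P ⟩
    -- Passing to indices in `Fin q` replaces `F._≈_` by propositional equality, so that exactly one
    -- summand can be singled out.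
    sum (map h (map I.from (allFin q)))
      ≡⟨ ≡.cong sum (Listₚ.map-∘ (allFin q)) ⟨
    sum (map (h ∘ I.from) (allFin q))
      ≡⟨ ≡.cong sum (Listₚ.map-tabulate id (h ∘ I.from)) ⟩
    sum (tabulate (h ∘ I.from))
      ≡⟨ sum-tabulate-single j₀ off-t₀ ⟩
    h (I.from j₀)
      ≡⟨ ≡.cong sum (Listₚ.map-cong (λ ω → order-≈ t _ ω (F.sym (I.strictlyInverseʳ (t 0)))) P) ⟩
    sum (map (suc ∘ order (t ∘ suc)) P)
      ≡⟨ sum-map-suc (order (t ∘ suc)) P ⟩
    length P ℕ.+ sum (map (order (t ∘ suc)) P)
      ≡⟨ ≡.cong₂ ℕ._+_ (length-polynomialsOfDegree< n) (sum-order n (t ∘ suc)) ⟩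
    q ^ n ℕ.+ orderD n
      ≡⟨ orderD-suc n ⟨
    orderD (suc n) ∎
    where
    open ≡.≡-Reasoning
    P  = polynomialsOfDegree< n
    j₀ = I.to (t 0)
    h : F.Carrier → ℕ
    h a = sum (map (λ ω → order t (a ∷ ω)) P)

    off-t₀ : ∀ i → i ≢ j₀ → h (I.from i) ≡ 0
    off-t₀ i i≢j₀ = ≡.trans
      (≡.cong sum (Listₚ.map-cong (λ ω → order-≉ t _ ω λ t₀≈ →
        i≢j₀ (≡.trans (≡.sym (I.strictlyInverseˡ i)) (I.to-cong (F.sym t₀≈)))) P))
      (sum-map-0 P)

  -- Absolute values of the Carlitz polynomials.

  ‖carlitzE‖ : ∀ n t → ¬ t (suc n) F.≈ F.0# → ‖ carlitzE (suc n) (series t) ‖ ≡ q^-ℕ orderD (suc n)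
  ‖carlitzE‖ n t tₙ≉0 = ≡.trans
    (‖productL‖ _ (order t) (All.map
      (λ {ω} len → ‖series-polynomial‖ t ω (≡.subst (λ m → ¬ t m F.≈ F.0#) (≡.sym len) tₙ≉0))
      (all-length (suc n))))
    (≡.cong q^-ℕ_ (sum-order (suc n) t))

  -- Since numerator and denominator have equal values, `Eₙ` can be traded for `Dₙ` under the
  -- absolute value, and the value of the inverse is never computed.
  ‖carlitzF‖ : ∀ n t → ¬ t (suc n) F.≈ F.0# → ‖ carlitzF (suc n) (series t) ‖ ≡ q^-ℕ 0
  ‖carlitzF‖ n t tₙ≉0 = begin
    ‖ Dₙ ⁻¹ * Eₙ ‖      ≡⟨ ‖‖-* (Dₙ ⁻¹) Eₙ ⟩
    ‖ Dₙ ⁻¹ ‖ · ‖ Eₙ ‖  ≡⟨ ≡.cong (‖ Dₙ ⁻¹ ‖ ·_) (≡.trans (‖carlitzE‖ n t tₙ≉0) (≡.sym (‖D‖ (suc n)))) ⟩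
    ‖ Dₙ ⁻¹ ‖ · ‖ Dₙ ‖  ≡⟨ ‖‖-* (Dₙ ⁻¹) Dₙ ⟨
    ‖ Dₙ ⁻¹ * Dₙ ‖      ≡⟨ ‖‖-cong (trans (*-comm (Dₙ ⁻¹) Dₙ) (*-inverseʳ (D≉0 (suc n)))) ⟩
    ‖ 1# ‖              ≡⟨ ‖1‖ ⟩
    q^-ℕ 0              ∎
    where
    open ≡.≡-Reasoning
    Dₙ = D (suc n)
    Eₙ = carlitzE (suc n) (series t)

  -- Divergence at points that are not polynomials.

  -- `Ω.sum` unfolds at the first index, whereas consecutive partial sums differ at the last.
  sum-last : ∀ (g : ℕ → Carrier) n → Ω.sum {suc n} (g ∘ toℕ) ≈ g n + Ω.sum {n} (g ∘ toℕ)
  sum-last g zero    = refl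
  sum-last g (suc n) = begin
    g 0 + Ω.sum {suc n} (g ∘ suc ∘ toℕ)            ≈⟨ +-congˡ (sum-last (g ∘ suc) n) ⟩
    g 0 + (g (suc n) + Ω.sum {n} (g ∘ suc ∘ toℕ))  ≈⟨ x∙yz≈y∙xz (g 0) (g (suc n)) _ ⟩
    g (suc n) + (g 0 + Ω.sum {n} (g ∘ suc ∘ toℕ))  ∎
    where
    open SetoidReasoning setoid
    open CommutativeSemigroupProperties +-commutativeSemigroup using (x∙yz≈y∙xz)

  partialSum-suc : ∀ c t n →
                   partialSum c t (suc n) - partialSum c t n ≈ c n * carlitzF n (series t)
  partialSum-suc c t n = trans (+-congʳ (sum-last (λ i → c i * carlitzF i (series t)) n))
    (//-rightDividesʳ (partialSum c t n) _)

  generic⇒stronglySingular : ∀ c → IsGeneric c → IsStronglySingular c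
  -- Precision exponent 1 forces late terms to have value at most `q^-ℕ 1`, strictly below the value
  -- `q^-ℕ 0` of a term with non-zero coefficient of `t`.
  generic⇒stronglySingular c (N , ‖cₙ‖≡1) t ¬polynomial (z , S⟶z) with S⟶z (+ 1 / 1)
  -- Beyond both thresholds `t` must vanish; the `suc` keeps the indices positive, as `‖carlitzF‖`
  -- requires.
  ... | M , close = ¬polynomial (suc (N ⊔ M) , vanishes)
    where
    increment≼ : ∀ n → M ≤ n → ‖ c n * carlitzF n (series t) ‖ ≼ q^-ℕ 1
    increment≼ n M≤n = ‖‖-resp (partialSum-suc c t n)
      (x-z (close (suc n) (ℕₚ.m≤n⇒m≤1+n M≤n)) (flip (+ 1 / 1) (close n M≤n)))

    increment≡ : ∀ n → N ≤ suc n → ¬ t (suc n) F.≈ F.0# →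
                 ‖ c (suc n) * carlitzF (suc n) (series t) ‖ ≡ q^-ℕ 0
    increment≡ n N≤n tₙ≉0 = ≡.trans (‖‖-* _ _)
      (≡.trans (≡.cong₂ _·_ (‖cₙ‖≡1 (suc n) N≤n) (‖carlitzF‖ n t tₙ≉0)) (·-homo-+ 0 0))

    vanishes : ∀ n → suc (N ⊔ M) ≤ n → t n F.≈ F.0#
    vanishes (suc n) (s≤s N⊔M≤n) with t (suc n) ≟ F.0#
    ... | yes tₙ≈0 = tₙ≈0
    ... | no  tₙ≉0 = ⊥-elim (<⇒≱ (/1-mono-< {+ 0} {+ 1} (ℤ.+<+ (s≤s z≤n))) (q^-≼⁻¹
      (≡.subst (_≼ q^-ℕ 1)
        (increment≡ n (ℕₚ.m≤n⇒m≤1+n (ℕₚ.≤-trans (ℕₚ.m≤m⊔n N M) N⊔M≤n)) tₙ≉0)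
        (increment≼ (suc n) (ℕₚ.m≤n⇒m≤1+n (ℕₚ.≤-trans (ℕₚ.m≤n⊔m N M) N⊔M≤n))))))

theorem4 : ∀ {ℓ₁ ℓ₂ : Level} {p q e : ℕ} (p-prime : Prime p) (q≡p^e : q ≡ p ^ suc e)
    (F : FiniteField ℓ₁ ℓ₂ q) (Ω : CompletedAlgebraicClosure (FiniteField.𝔽 F)) →
    let open CompletedAlgebraicClosure Ω using (Carrier)
        open Carlitz {e = e} p-prime q≡p^e F Ω
    in (a b : ℤ) (c : ℕ → Carrier) →
       SolvesEquation a b (sumOnPolynomials c) ⊎ SolvesRecursion a b c →
       IsGeneric c → IsStronglySingular c
theorem4 {e = e} p-prime q≡p^e F Ω a b c _ = generic⇒stronglySingular {e = e} p-prime q≡p^e F Ω c
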